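{- Let $m\ge 2$ and $z\ge 1$ be integers. Algorithm SE-C runs in time $\mathcal{O}(nmz+nm^2)$ to create a graph of $n$ vertices.
   Context: **Random systematic sampling (RSS).** Input: elements $x_1,\dots,x_N$ with integer frequencies $d_1,\dots,d_N$, $s=\sum_i d_i$, and a sample size $m$ dividing $s$. Shuffle the elements (together with their frequencies), draw $r$ uniformly from $[0,s/m)$, set $psum=0$, and scan $i=1,\dots,N$: add $d_i$ to $psum$, and if $psum>r$, output $x_i$ and increase $r$ by $s/m$. **Random systematic partitioning (RSP).** Input: elements $x_1,\dots,x_N$ with frequencies $d_1,\dots,d_N$ and integers $s,m$ with $\sum_i d_i=sm$ and maximum frequency at most $s$ (frequencies not known in advance can be created in one pass). Start with empty sets $H_1,\dots,H_s$ and $k=1$; shuffle the elements; for each element in the shuffled order, as many times as its frequency, add it to $H_k$ and set $k\leftarrow(k\bmod s)+1$. Output $H_1,\dots,H_s$. **Algorithm SE-C.** The state is a graph $\mathcal{G}(V,E)$ and a list $H$ of hyperedges (repetitions allowed), each hyperedge being a set of vertices. Start with a connected graph $\mathcal{G}_0(V_0,E_0)$ such that $m$ divides $2|E_0|$ and no vertex has degree higher than $2|E_0|/m$, and initialize $H$ as a list of $2|E_0|/m$ hyperedges, each consisting of exactly $m$ distinct vertices, such that each vertex lies in exactly as many hyperedges as its degree in $\mathcal{G}_0$. While $|V|<n$ (where $n$ is the desired number of vertices), perform a round: (1) select $z$ hyperedges from $H$ uniformly at random with replacement; (2) apply RSS with sample size $m$ to the union of the vertices of these hyperedges, each vertex with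 frequency equal to the number of selected hyperedges (with multiplicity) containing it, to obtain $u=(u_1,\dots,u_m)$; (3) add a new vertex $v$ to $V$ and the edges $(v,u_1),\dots,(v,u_m)$ to $E$; (4) update $H$: select (without replacement) and remove $m-2$ hyperedges $h_1,\dots,h_{m-2}$ from $H$; form the bag $A$ consisting of the $m(m-2)$ elements of $h_1,\dots,h_{m-2}$, $m$ copies of $v$, and all elements of $u$; perform RSP on $A$ with $s=m$, and add the resulting $m$ sets to $H$.
   Formalization: That the run ends with n vertices is stated only if the initial list H has at least max(1, m−2) hyperedges, since otherwise a round cannot be executed; the time bound needs no such condition. The initial graph and H are given as input, so their construction is not charged. -}

module Defs where

open import Data.Bool using (Bool; true; false; if_then_else_)
open import Data.Fin using (Fin; toℕ)
open import Data.Fin.Properties using (_≟_)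
open import Data.List using (List; []; _∷_; length; filter; map; concatMap)
open import Data.List.Membership.Propositional using (_∈_)
open import Data.List.Relation.Unary.All using (All)
open import Data.List.Relation.Unary.AllPairs using (AllPairs)
open import Data.Nat
  using (ℕ; zero; suc; _+_; _*_; _∸_; _/_; _%_; _≤_; _<_; _≮_; _≡ᵇ_; NonZero)
open import Data.Nat.Divisibility using (_∣_; quotient)
open import Data.Product using (_×_; _,_; proj₁; proj₂)
open import Data.Sum using (_⊎_)
open import Data.Vec using (Vec; toList)
import Data.Vec.Membership.DecPropositional as VecMembership
open import Data.Vec.Relation.Unary.Unique.Propositional using (Unique)
open import Relation.Binary.Construct.Closure.ReflexiveTransitive using (Star)
open import Relation.Binary.PropositionalEquality using (_≡_; _≢_)
open import Relation.Nullary using (¬_; Dec; yes; no)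
open import Relation.Nullary.Decidable using (_⊎-dec_)

------------------------------------------------------------------------
-- Graphs

-- Each edge is listed once, in one of its two orientations.
record Graph : Set where
  field
    order    : ℕ
    edges    : List (Fin order × Fin order)
    loopless : All (λ e → proj₁ e ≢ proj₂ e) edges
    simple   : AllPairs (λ e f → e ≢ f × e ≢ (proj₂ f , proj₁ f)) edges

  Vertex : Set
  Vertex = Fin order

  Adjacent : Vertex → Vertex → Set
  Adjacent a b = (a , b) ∈ edges ⊎ (b , a) ∈ edges

  -- The graph without vertices does not count as connected.
  Connected : Set
  Connected = NonZero order × (∀ a b → Star Adjacent a b)

  degree : Vertex → ℕ
  degree v = length (filter (λ e → (v ≟ proj₁ e) ⊎-dec (v ≟ proj₂ e)) edges)

-- The data from which SE-C starts: 𝒢₀ and the initial list of hyperedges.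
-- A hyperedge is an m-element set of vertices, listed without repetition.
record Seed (m : ℕ) : Set where
  field
    graph : Graph
  open Graph graph public
  open VecMembership (_≟_ {order}) using (_∈?_)
  field
    connected  : Connected
    divisible  : m ∣ 2 * length edges
    degree≤    : ∀ v → degree v ≤ quotient divisible
    hyperedges : List (Vec Vertex m)
    number     : length hyperedges ≡ quotient divisible
    distinct   : All Unique hyperedges
    incidence  : ∀ v → length (filter (v ∈?_) hyperedges) ≡ degree v

------------------------------------------------------------------------
-- A unit-cost random access machine with a structured program syntax

data Reg : Set where
  register : ℕ → Reg

data Arr : Set where
  array : ℕ → Arr

infix  20 $_ #_
infixl 19 _[_]
infixl 17 _⊗_ _⊘_ _⊛_
infixl 16 _⊕_ _⊖_
infix  14 _≺_ _≐_
infix  12 _≔_ _[_]≔_ _←uniform_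
infix  11 if_then_else′_ while_repeat_ for_below_repeat_
infixr 10 _⨾_

data Exp : Set where
  $_                      : Reg → Exp
  #_                      : ℕ → Exp
  _[_]                    : Arr → Exp → Exp
  _⊕_ _⊖_ _⊗_ _⊘_ _⊛_     : Exp → Exp → Exp

data Test : Set where
  _≺_ _≐_ : Exp → Exp → Test

data Cmd : Set where
  skip            : Cmd
  _≔_             : Reg → Exp → Cmd
  _[_]≔_          : Arr → Exp → Exp → Cmd
  _←uniform_      : Reg → Exp → Cmd
  _⨾_             : Cmd → Cmd → Cmd
  if_then_else′_  : Test → Cmd → Cmd → Cmd
  while_repeat_       : Test → Cmd → Cmd

record State : Set where
  constructor ⟪_,_⟫
  field
    reg : Reg → ℕ
    mem : Arr → ℕ → ℕ
open State public

setReg : Reg → ℕ → State → State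
setReg (register x) v σ .reg (register y) = if x ≡ᵇ y then v else reg σ (register y)
setReg x     v σ .mem       = mem σ

setMem : Arr → ℕ → ℕ → State → State
setMem a     i v σ .reg         = reg σ
setMem (array a) i v σ .mem (array b) j =
  if a ≡ᵇ b then (if i ≡ᵇ j then v else mem σ (array b) j) else mem σ (array b) j

quo rem : ℕ → ℕ → ℕ
quo a zero    = 0
quo a (suc b) = a / suc b
rem a zero    = a
rem a (suc b) = a % suc b

⟦_⟧ : Exp → State → ℕ
⟦ $ x ⟧     σ = reg σ x
⟦ # k ⟧     σ = k
⟦ a [ e ] ⟧ σ = mem σ a (⟦ e ⟧ σ)
⟦ e ⊕ f ⟧   σ = ⟦ e ⟧ σ + ⟦ f ⟧ σ
⟦ e ⊖ f ⟧   σ = ⟦ e ⟧ σ ∸ ⟦ f ⟧ σ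
⟦ e ⊗ f ⟧   σ = ⟦ e ⟧ σ * ⟦ f ⟧ σ
⟦ e ⊘ f ⟧   σ = quo (⟦ e ⟧ σ) (⟦ f ⟧ σ)
⟦ e ⊛ f ⟧   σ = rem (⟦ e ⟧ σ) (⟦ f ⟧ σ)

Holds : Test → State → Set
Holds (e ≺ f) σ = ⟦ e ⟧ σ < ⟦ f ⟧ σ
Holds (e ≐ f) σ = ⟦ e ⟧ σ ≡ ⟦ f ⟧ σ

-- The time needed to evaluate an expression is the number of its nodes.
time : Exp → ℕ
time ($ x)     = 1
time (# k)     = 1
time (a [ e ]) = 1 + time e
time (e ⊕ f)   = 1 + time e + time f
time (e ⊖ f)   = 1 + time e + time f
time (e ⊗ f)   = 1 + time e + time f
time (e ⊘ f)   = 1 + time e + time f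
time (e ⊛ f)   = 1 + time e + time f

timeᵗ : Test → ℕ
timeᵗ (e ≺ f) = 1 + time e + time f
timeᵗ (e ≐ f) = 1 + time e + time f

Config : Set
Config = Cmd × State

-- κ ⟶[ t ] κ′: one transition, taking time t.  A uniform draw below k has
-- one transition for each of its k equally likely outcomes; a draw below 0
-- has none, so that the machine is stuck.
infix 4 _⟶[_]_ _⟶*[_]_

data _⟶[_]_ : Config → ℕ → Config → Set where
  assign  : ∀ {x e σ} →
            (x ≔ e , σ) ⟶[ 1 + time e ] (skip , setReg x (⟦ e ⟧ σ) σ)
  store   : ∀ {a e f σ} →
            (a [ e ]≔ f , σ) ⟶[ 1 + time e + time f ]
            (skip , setMem a (⟦ e ⟧ σ) (⟦ f ⟧ σ) σ)
  draw    : ∀ {x e σ r} → r < ⟦ e ⟧ σ →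
            (x ←uniform e , σ) ⟶[ 1 + time e ] (skip , setReg x r σ)
  seq     : ∀ {c c′ d σ σ′ t} → (c , σ) ⟶[ t ] (c′ , σ′) →
            (c ⨾ d , σ) ⟶[ t ] (c′ ⨾ d , σ′)
  next    : ∀ {d σ} → (skip ⨾ d , σ) ⟶[ 1 ] (d , σ)
  if-yes  : ∀ {b c d σ} → Holds b σ →
            (if b then c else′ d , σ) ⟶[ 1 + timeᵗ b ] (c , σ)
  if-no   : ∀ {b c d σ} → ¬ Holds b σ →
            (if b then c else′ d , σ) ⟶[ 1 + timeᵗ b ] (d , σ)
  loop    : ∀ {b c σ} → Holds b σ →
            (while b repeat c , σ) ⟶[ 1 + timeᵗ b ] (c ⨾ while b repeat c , σ)
  exit    : ∀ {b c σ} → ¬ Holds b σ →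
            (while b repeat c , σ) ⟶[ 1 + timeᵗ b ] (skip , σ)

data _⟶*[_]_ : Config → ℕ → Config → Set where
  ε   : ∀ {κ} → κ ⟶*[ 0 ] κ
  _◅_ : ∀ {κ κ′ κ″ t u} → κ ⟶[ t ] κ′ → κ′ ⟶*[ u ] κ″ → κ ⟶*[ t + u ] κ″

Terminal : Config → Set
Terminal κ = ∀ {t κ′} → ¬ (κ ⟶[ t ] κ′)

if_then′_ : Test → Cmd → Cmd
if b then′ c = if b then c else′ skip
infix 11 if_then′_

for_below_repeat_ : Reg → Exp → Cmd → Cmd
for x below e repeat c = x ≔ # 0 ⨾ while $ x ≺ e repeat (c ⨾ x ≔ $ x ⊕ # 1)

------------------------------------------------------------------------
-- Registers and arrays

-- Parameters m, z, n, and the sizes of V, E and H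
pattern %m  = register 0
pattern %z  = register 1
pattern %n  = register 2
pattern ∣V∣ = register 3
pattern ∣E∣ = register 4
pattern ∣H∣ = register 5

pattern %i    = register 6
pattern %j    = register 7
pattern %k    = register 8
pattern %a    = register 9
pattern %b    = register 10
pattern %N    = register 11
pattern %s    = register 12
pattern %r    = register 13
pattern %psum = register 14
pattern %v    = register 15
pattern %q    = register 16
pattern %l    = register 17

-- Edge number e joins Src[e] and Dst[e]; hyperedge number j consists of
-- Hyp[j*m], …, Hyp[j*m+m-1].
pattern Src  = array 0
pattern Dst  = array 1
pattern Hyp  = array 2

pattern Sel  = array 3
pattern Elem = array 4
pattern Freq = array 5
pattern Idx  = array 6
pattern Out  = array 7
pattern Bag  = array 8
pattern Part = array 9
pattern Len  = array 10

------------------------------------------------------------------------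
-- Algorithm SE-C

-- The frequency table: N distinct elements Elem[0], …, Elem[N-1] with
-- frequencies Freq[0], …, Freq[N-1].  While it is being filled, Idx[x] is 1
-- plus the position of x in Elem, or 0 if x is not in the table.  `tally` adds
-- one occurrence of the element in register %a.
tally : Cmd
tally =
  if Idx [ $ %a ] ≐ # 0
  then (Elem [ $ %N ]≔ $ %a ⨾
        Freq [ $ %N ]≔ # 1 ⨾
        %N ≔ $ %N ⊕ # 1 ⨾
        Idx [ $ %a ]≔ $ %N)
  else′ (Freq [ Idx [ $ %a ] ⊖ # 1 ]≔ Freq [ Idx [ $ %a ] ⊖ # 1 ] ⊕ # 1)

clear : Cmd
clear =
  for %i below $ %N repeat (Idx [ Elem [ $ %i ] ]≔ # 0) ⨾
  %N ≔ # 0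

-- Fisher–Yates
shuffle : Cmd
shuffle =
  %i ≔ $ %N ⨾
  while # 1 ≺ $ %i repeat (
    %i ≔ $ %i ⊖ # 1 ⨾
    %j ←uniform ($ %i ⊕ # 1) ⨾
    %a ≔ Elem [ $ %i ] ⨾ Elem [ $ %i ]≔ Elem [ $ %j ] ⨾ Elem [ $ %j ]≔ $ %a ⨾
    %b ≔ Freq [ $ %i ] ⨾ Freq [ $ %i ]≔ Freq [ $ %j ] ⨾ Freq [ $ %j ]≔ $ %b)

-- RSS of the frequency table with the given sample size; output in Out.
-- Since psum and s/m are integers, drawing r from the integers below s/m
-- makes the same selections as drawing it from the real interval [0,s/m).
rss : Exp → Cmd
rss size =
  %s ≔ # 0 ⨾
  for %i below $ %N repeat (%s ≔ $ %s ⊕ Freq [ $ %i ]) ⨾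
  shuffle ⨾
  %r ←uniform ($ %s ⊘ size) ⨾
  %psum ≔ # 0 ⨾
  %k ≔ # 0 ⨾
  for %i below $ %N repeat (
    %psum ≔ $ %psum ⊕ Freq [ $ %i ] ⨾
    if $ %r ≺ $ %psum then′ (
      Out [ $ %k ]≔ Elem [ $ %i ] ⨾
      %k ≔ $ %k ⊕ # 1 ⨾
      %r ≔ $ %r ⊕ ($ %s ⊘ size)))

-- RSP of the frequency table into `sets` sets of `size` elements each.  The
-- k-th set (1 ≤ k ≤ sets) is stored in Part from position (k-1)*size on, and
-- Len[k] is the number of elements it has received.
rsp : (sets size : Exp) → Cmd
rsp sets size =
  for %k below sets repeat (Len [ $ %k ⊕ # 1 ]≔ # 0) ⨾
  %k ≔ # 1 ⨾
  shuffle ⨾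
  for %i below $ %N repeat (
    for %j below Freq [ $ %i ] repeat (
      Part [ ($ %k ⊖ # 1) ⊗ size ⊕ Len [ $ %k ] ]≔ Elem [ $ %i ] ⨾
      Len [ $ %k ]≔ Len [ $ %k ] ⊕ # 1 ⨾
      %k ≔ ($ %k ⊛ sets) ⊕ # 1))

selectHyperedges : Cmd
selectHyperedges =
  for %k below $ %z repeat (
    %j ←uniform $ ∣H∣ ⨾
    Sel [ $ %k ]≔ $ %j)

sampleVertices : Cmd
sampleVertices =
  for %k below $ %z repeat
    for %i below $ %m repeat (
      %a ≔ Hyp [ Sel [ $ %k ] ⊗ $ %m ⊕ $ %i ] ⨾
      tally) ⨾
  rss ($ %m) ⨾
  clear

attachVertex : Cmd
attachVertex =
  %v ≔ $ ∣V∣ ⨾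
  ∣V∣ ≔ $ ∣V∣ ⊕ # 1 ⨾
  for %i below $ %m repeat (
    Src [ $ ∣E∣ ]≔ $ %v ⨾
    Dst [ $ ∣E∣ ]≔ Out [ $ %i ] ⨾
    ∣E∣ ≔ $ ∣E∣ ⊕ # 1)

toBag : Exp → Cmd
toBag e = Bag [ $ %q ]≔ e ⨾ %q ≔ $ %q ⊕ # 1

-- A removed hyperedge is overwritten by the last one of the list.
updateHyperedges : Cmd
updateHyperedges =
  %q ≔ # 0 ⨾
  for %k below $ %m ⊖ # 2 repeat (
    %j ←uniform $ ∣H∣ ⨾
    ∣H∣ ≔ $ ∣H∣ ⊖ # 1 ⨾
    for %i below $ %m repeat (
      toBag (Hyp [ $ %j ⊗ $ %m ⊕ $ %i ]) ⨾
      Hyp [ $ %j ⊗ $ %m ⊕ $ %i ]≔ Hyp [ $ ∣H∣ ⊗ $ %m ⊕ $ %i ])) ⨾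
  for %i below $ %m repeat toBag ($ %v) ⨾
  for %i below $ %m repeat toBag (Out [ $ %i ]) ⨾
  for %l below $ %q repeat (
    %a ≔ Bag [ $ %l ] ⨾
    tally) ⨾
  rsp ($ %m) ($ %m) ⨾
  clear ⨾
  for %k below $ %m repeat (
    for %i below $ %m repeat
      (Hyp [ $ ∣H∣ ⊗ $ %m ⊕ $ %i ]≔ Part [ $ %k ⊗ $ %m ⊕ $ %i ]) ⨾
    ∣H∣ ≔ $ ∣H∣ ⊕ # 1)

SE-C : Cmd
SE-C =
  while $ ∣V∣ ≺ $ %n repeat (
    selectHyperedges ⨾
    sampleVertices ⨾
    attachVertex ⨾
    updateHyperedges)

------------------------------------------------------------------------
-- The initial state

at : List ℕ → ℕ → ℕ
at []       _       = 0
at (x ∷ xs) zero    = x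
at (x ∷ xs) (suc p) = at xs p

-- The seed is in memory when SE-C starts: its size is not bounded in terms
-- of n, m and z alone, since 𝒢₀ may have of the order of n² edges.
initial : ∀ {m} → Seed m → (z n : ℕ) → State
initial {m} S z n = ⟪ registers , arrays ⟫
  where
  open Seed S

  registers : Reg → ℕ
  registers %m  = m
  registers %z  = z
  registers %n  = n
  registers ∣V∣ = order
  registers ∣E∣ = length edges
  registers ∣H∣ = length hyperedges
  registers _   = 0

  arrays : Arr → ℕ → ℕ
  arrays Src = at (map (λ e → toℕ (proj₁ e)) edges)
  arrays Dst = at (map (λ e → toℕ (proj₂ e)) edges)
  arrays Hyp = at (concatMap (λ h → map toℕ (toList h)) hyperedges)
  arrays _   = λ _ → 0

{-# OPTIONS --safe #-}
module Submission where

-- Since every expression has constant size, the time of a run is at most a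
-- constant plus a constant times the number of loop iterations.  A round makes
-- O(mz + m²) of these: the frequency table never holds more elements than were
-- tallied into it (zm for RSS, m² for RSP), and the inner loop of RSP runs as
-- often as the sum of all frequencies, which is the number of tallies.  A run
-- can only get stuck at a draw from the empty range.  The range is ⌊zm/m⌋ = z
-- in RSS, and ∣H∣ ≥ max(1, m-2) persists because each round leaves at least m
-- hyperedges.

open import Defs
open import Data.Bool using (true; false; if_then_else_)
open import Data.Empty using (⊥-elim)
open import Data.List using (length)
open import Data.Nat
  using (ℕ; zero; suc; _+_; _*_; _∸_; _⊔_; _≤_; _<_; _≡ᵇ_; _<?_; z≤n; s≤s;
         >-nonZero; >-nonZero⁻¹)
open import Data.Nat.DivMod using (m*n/n≡m)
open import Data.Nat.Properties
open import Data.Nat.Tactic.RingSolver using (solve-∀)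
open import Algebra.Properties.CommutativeSemigroup +-commutativeSemigroup
  using (xy∙z≈xz∙y)
open import Data.Product using (∃-syntax; _×_; _,_; proj₁; proj₂)
open import Data.Sum using (_⊎_; inj₁; inj₂)
open import Function using (_∘_)
open import Relation.Binary.PropositionalEquality
  using (_≡_; _≢_; refl; sym; trans; cong; cong₂; subst; subst₂; module ≡-Reasoning)
open import Relation.Nullary using (¬_; Dec; yes; no)

-- Time against loop iterations

unrollings : ∀ {κ κ′ t} → κ ⟶[ t ] κ′ → ℕ
unrollings (seq s)  = unrollings s
unrollings (loop _) = 1
unrollings _        = 0

-- The time of `c` when every loop is left at its first test.
flat : Cmd → ℕ
flat skip                 = 0
flat (x ≔ e)              = 1 + time e
flat (a [ e ]≔ f)         = 1 + time e + time f
flat (x ←uniform e)       = 1 + time e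
flat (c ⨾ d)              = flat c + (1 + flat d)
flat (if b then c else′ d) = 1 + timeᵗ b + (flat c + flat d)
flat (while b repeat c)   = 1 + timeᵗ b

-- The largest increase of `flat` plus time spent in unrolling a loop of `c`.
loopCost : Cmd → ℕ
loopCost (c ⨾ d)               = loopCost c ⊔ loopCost d
loopCost (if b then c else′ d) = loopCost c ⊔ loopCost d
loopCost (while b repeat c)    = loopCost c ⊔ (1 + timeᵗ b + (flat c + 1))
loopCost _                     = 0

-- `flat` acts as a potential: a step is paid for by the part of the command that it consumes, and a
-- conditional also gives up its other branch. Only unrolling a loop raises it, by the test, the
-- body and one sequencing step, which is the second argument of the maximum in `loopCost`.
step-flat : ∀ {K c σ t c′ σ′} (s : (c , σ) ⟶[ t ] (c′ , σ′)) → loopCost c ≤ K →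
            t + flat c′ ≤ flat c + unrollings s * K
step-flat assign   _ = ≤-refl
step-flat store    _ = ≤-refl
step-flat (draw _) _ = ≤-refl
step-flat {K} (seq {c} {c′} {d} {t = t} s) le = begin
  t + (flat c′ + (1 + flat d))               ≡⟨ +-assoc t _ _ ⟨
  t + flat c′ + (1 + flat d)                 ≤⟨ +-monoˡ-≤ _ (step-flat s (m⊔n≤o⇒m≤o _ _ le)) ⟩
  flat c + unrollings s * K + (1 + flat d)   ≡⟨ xy∙z≈xz∙y (flat c) _ _ ⟩
  flat c + (1 + flat d) + unrollings s * K   ∎
  where open ≤-Reasoning
step-flat next _ = ≤-reflexive (sym (+-identityʳ _))
step-flat (if-yes {b} {c} {d} _) _ =
  ≤-trans (+-monoʳ-≤ (1 + timeᵗ b) (m≤m+n (flat c) (flat d))) (m≤m+n _ 0)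
step-flat (if-no {b} {c} {d} _) _ =
  ≤-trans (+-monoʳ-≤ (1 + timeᵗ b) (m≤n+m (flat d) (flat c))) (m≤m+n _ 0)
step-flat {K} (loop {b} {c} _) le = begin
  B + (flat c + (1 + B))  ≡⟨ cong (B +_) (+-assoc (flat c) 1 B) ⟨
  B + (flat c + 1 + B)    ≡⟨ +-assoc B (flat c + 1) B ⟨
  B + (flat c + 1) + B    ≤⟨ +-monoˡ-≤ B (m⊔n≤o⇒n≤o (loopCost c) _ le) ⟩
  K + B                   ≡⟨ +-comm K B ⟩
  B + K                   ≡⟨ cong (B +_) (*-identityˡ K) ⟨
  B + 1 * K               ∎
  where
  open ≤-Reasoning
  B = 1 + timeᵗ b
step-flat (exit _) _ = ≤-refl

-- Keeps one `K` valid along a whole run: unrolling copies the body of a loop, whose cost already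
-- enters the maximum.
step-loopCost : ∀ {c σ t c′ σ′} → (c , σ) ⟶[ t ] (c′ , σ′) → loopCost c′ ≤ loopCost c
step-loopCost assign               = z≤n
step-loopCost store                = z≤n
step-loopCost (draw _)             = z≤n
step-loopCost (seq {d = d} s)      = ⊔-monoˡ-≤ (loopCost d) (step-loopCost s)
step-loopCost next                 = ≤-refl
step-loopCost (if-yes {c = c} {d} _) = m≤m⊔n (loopCost c) (loopCost d)
step-loopCost (if-no {c = c} {d} _)  = m≤n⊔m (loopCost c) (loopCost d)
step-loopCost (loop {c = c} _)     = ⊔-lub (m≤m⊔n (loopCost c) _) ≤-refl
step-loopCost (exit _)             = z≤n

-- Sums and updates of functions on ℕ

∑ : ℕ → (ℕ → ℕ) → ℕ
∑ zero    f = 0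
∑ (suc n) f = ∑ n f + f n

∑-const : ∀ n k → ∑ n (λ _ → k) ≡ n * k
∑-const zero    k = refl
∑-const (suc n) k = trans (cong (_+ k) (∑-const n k)) (+-comm (n * k) k)

∑-suc : ∀ n f → ∑ n (suc ∘ f) ≡ n + ∑ n f
∑-suc zero    f = refl
∑-suc (suc n) f = begin
  ∑ n (suc ∘ f) + suc (f n)  ≡⟨ cong (_+ suc (f n)) (∑-suc n f) ⟩
  n + ∑ n f + suc (f n)      ≡⟨ +-suc _ (f n) ⟩
  suc (n + ∑ n f + f n)      ≡⟨ cong suc (+-assoc n _ _) ⟩
  suc (n + (∑ n f + f n))    ∎
  where open ≡-Reasoning

∑-mono : ∀ {i n} f → i ≤ n → ∑ i f ≤ ∑ n f
∑-mono {n = zero}  f z≤n = ≤-refl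
∑-mono {i} {suc n} f le with m≤n⇒m<n∨m≡n le
... | inj₁ (s≤s i≤n) = ≤-trans (∑-mono f i≤n) (m≤m+n _ _)
... | inj₂ refl      = ≤-refl

infixl 8 _[_↦_]

-- Written with the same conditional as `setMem`, so that facts about updates apply to the memory of
-- the machine by computation alone.
_[_↦_] : (ℕ → ℕ) → ℕ → ℕ → ℕ → ℕ
(f [ i ↦ v ]) j = if i ≡ᵇ j then v else f j

update-≡ : ∀ f i {v} → (f [ i ↦ v ]) i ≡ v
update-≡ f i with i ≡ᵇ i | ≡⇒≡ᵇ i i refl
... | true | _ = refl

update-≢ : ∀ f {i j v} → i ≢ j → (f [ i ↦ v ]) j ≡ f j
update-≢ f {i} {j} i≢j with i ≡ᵇ j | ≡ᵇ⇒≡ i j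
... | true  | eq = ⊥-elim (i≢j (eq _))
... | false | _  = refl

∑-update-≥ : ∀ {n p} f {v} → n ≤ p → ∑ n (f [ p ↦ v ]) ≡ ∑ n f
∑-update-≥ {zero}      f n≤p = refl
∑-update-≥ {suc n} {p} f n<p =
  cong₂ _+_ (∑-update-≥ f (<⇒≤ n<p)) (update-≢ f (>⇒≢ n<p))

-- The old value `f p` stands on the left so that no truncated subtraction occurs.
∑-update : ∀ {n p} f {v} → p < n → ∑ n (f [ p ↦ v ]) + f p ≡ ∑ n f + v
∑-update {suc n} {p} f {v} (s≤s p≤n) with m≤n⇒m<n∨m≡n p≤n
... | inj₂ refl = begin
  ∑ n (f [ n ↦ v ]) + (f [ n ↦ v ]) n + f n  ≡⟨ cong₂ (λ a b → a + b + f n)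
                                                       (∑-update-≥ f (≤-refl {n})) (update-≡ f n) ⟩
  ∑ n f + v + f n                            ≡⟨ xy∙z≈xz∙y (∑ n f) v (f n) ⟩
  ∑ n f + f n + v                            ∎
  where open ≡-Reasoning
... | inj₁ p<n = begin
  ∑ n (f [ p ↦ v ]) + (f [ p ↦ v ]) n + f p  ≡⟨ cong (λ b → ∑ n (f [ p ↦ v ]) + b + f p) (update-≢ f (<⇒≢ p<n)) ⟩
  ∑ n (f [ p ↦ v ]) + f n + f p              ≡⟨ xy∙z≈xz∙y (∑ n (f [ p ↦ v ])) _ _ ⟩
  ∑ n (f [ p ↦ v ]) + f p + f n              ≡⟨ cong (_+ f n) (∑-update f p<n) ⟩
  ∑ n f + v + f n                            ≡⟨ xy∙z≈xz∙y (∑ n f) v (f n) ⟩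
  ∑ n f + f n + v                            ∎
  where open ≡-Reasoning

-- The updates are composed in the order of the assignments in `shuffle`, where the old `f i` waits
-- in a register.
swap : ℕ → ℕ → (ℕ → ℕ) → ℕ → ℕ
swap i j f = f [ i ↦ f j ] [ j ↦ f i ]

∑-swap : ∀ {n i j} f → i < n → j < n → ∑ n (swap i j f) ≡ ∑ n f
∑-swap {n} {i} {j} f i<n j<n = +-cancelʳ-≡ (f j) _ _ (begin
  ∑ n (swap i j f) + f j  ≡⟨ cong (∑ n (swap i j f) +_) (gj i j) ⟨
  ∑ n (swap i j f) + g j  ≡⟨ ∑-update g j<n ⟩
  ∑ n g + f i             ≡⟨ ∑-update f i<n ⟩
  ∑ n f + f j             ∎)
  where
  open ≡-Reasoning
  g = f [ i ↦ f j ]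
  -- If `i` and `j` coincide, the first update writes back the value already there.
  gj : ∀ i j → (f [ i ↦ f j ]) j ≡ f j
  gj i j with i ≟ j
  ... | yes refl = update-≡ f i
  ... | no i≢j   = update-≢ f i≢j

swap-surjective : ∀ {n i j} f → i < n → j < n → ∀ {p} → p < n →
                  ∃[ q ] q < n × swap i j f q ≡ f p
swap-surjective {i = i} {j} f i<n j<n {p} p<n with p ≟ i | p ≟ j
... | yes refl | _       = j , j<n , update-≡ (f [ i ↦ f j ]) j
... | no p≢i | no p≢j    =
  p , p<n , trans (update-≢ (f [ i ↦ f j ]) (p≢j ∘ sym)) (update-≢ f (p≢i ∘ sym))
... | no p≢i | yes refl  = i , i<n , trans (update-≢ (f [ i ↦ f j ]) p≢i) (update-≡ f i)

-- The frequency table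

-- After k tallies.  The conditions on idx are weak enough to survive shuffling,
-- which leaves Idx as it is, and strong enough for `clear` to reset it.
record Table (k N : ℕ) (elem freq idx : ℕ → ℕ) : Set where
  field
    total   : ∑ N freq ≡ k
    size    : N ≤ k
    idx≤    : ∀ x → idx x ≤ N
    listed  : ∀ x → idx x ≡ 0 ⊎ ∃[ p ] p < N × elem p ≡ x
open Table

empty-table : ∀ {N elem freq idx} → N ≡ 0 → (∀ x → idx x ≡ 0) → Table 0 N elem freq idx
empty-table refl idx≡0 = record
  { total  = refl
  ; size   = z≤n
  ; idx≤   = λ x → ≤-reflexive (idx≡0 x)
  ; listed = inj₁ ∘ idx≡0
  }

tally-new : ∀ {k N elem freq idx} a → Table k N elem freq idx →
            Table (suc k) (N + 1) (elem [ N ↦ a ]) (freq [ N ↦ 1 ]) (idx [ a ↦ N + 1 ])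
tally-new {k} {N} {elem} {freq} {idx} a T rewrite +-comm N 1 = record
  { total  = trans (cong₂ _+_ (trans (∑-update-≥ freq (≤-refl {N})) (T .total)) (update-≡ freq N))
                   (+-comm k 1)
  ; size   = s≤s (T .size)
  ; idx≤   = idx≤′
  ; listed = listed′
  }
  where
  idx≤′ : ∀ x → (idx [ a ↦ suc N ]) x ≤ suc N
  idx≤′ x with a ≟ x
  ... | yes refl = ≤-reflexive (update-≡ idx a)
  ... | no a≢x   = ≤-trans (≤-reflexive (update-≢ idx a≢x)) (m≤n⇒m≤1+n (T .idx≤ x))
  listed′ : ∀ x → (idx [ a ↦ suc N ]) x ≡ 0 ⊎ ∃[ p ] p < suc N × (elem [ N ↦ a ]) p ≡ x
  listed′ x with a ≟ x
  ... | yes refl = inj₂ (N , ≤-refl , update-≡ elem N)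
  ... | no a≢x with T .listed x
  ...   | inj₁ idx≡0          = inj₁ (trans (update-≢ idx a≢x) idx≡0)
  ...   | inj₂ (p , p<N , eq) = inj₂ (p , m≤n⇒m≤1+n p<N , trans (update-≢ elem (>⇒≢ p<N)) eq)

-- A nonzero index is at most `N`, so the position one below it lies in the summed range and the
-- increment raises the total by exactly 1.
tally-old : ∀ {k N elem freq idx} a → idx a ≢ 0 → Table k N elem freq idx →
            Table (suc k) N elem (freq [ idx a ∸ 1 ↦ freq (idx a ∸ 1) + 1 ]) idx
tally-old {k} {N} {freq = freq} {idx} a idx≢0 T = record
  { total  = +-cancelʳ-≡ (freq p) _ _ (begin
      ∑ N (freq [ p ↦ freq p + 1 ]) + freq p  ≡⟨ ∑-update freq p<N ⟩
      ∑ N freq + (freq p + 1)                 ≡⟨ cong₂ _+_ (T .total) (+-comm (freq p) 1) ⟩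
      k + suc (freq p)                        ≡⟨ +-suc k (freq p) ⟩
      suc k + freq p                          ∎)
  ; size   = m≤n⇒m≤1+n (T .size)
  ; idx≤   = T .idx≤
  ; listed = T .listed
  }
  where
  open ≡-Reasoning
  p = idx a ∸ 1
  p<N : p < N
  p<N = ≤-trans (≤-reflexive (m+[n∸m]≡n (n≢0⇒n>0 idx≢0))) (T .idx≤ a)

swap-table : ∀ {k N elem freq idx i j} → i < N → j < N → Table k N elem freq idx →
             Table k N (swap i j elem) (swap i j freq) idx
swap-table {elem = elem} {freq} i<N j<N T = record
  { total  = trans (∑-swap freq i<N j<N) (T .total)
  ; size   = T .size
  ; idx≤   = T .idx≤
  ; listed = λ x → listed′ x (T .listed x)
  }
  where
  listed′ : ∀ x → _ ⊎ _ → _ ⊎ _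
  listed′ x (inj₁ idx≡0)          = inj₁ idx≡0
  listed′ x (inj₂ (p , p<N , eq)) with swap-surjective elem i<N j<N p<N
  ... | q , q<N , eq′ = inj₂ (q , q<N , trans eq′ eq)

-- A program logic

holds? : ∀ b σ → Dec (Holds b σ)
holds? (e ≺ f) σ = ⟦ e ⟧ σ <? ⟦ f ⟧ σ
holds? (e ≐ f) σ = ⟦ e ⟧ σ ≟ ⟦ f ⟧ σ

module Logic (Live : Set) where

  -- The budget n counts loop iterations.  Live is the hypothesis under which runs
  -- must not get stuck; without it, draws may block.
  data Within (Q : State → Set) : ℕ → Cmd → State → Set where
    done : ∀ {n σ} → Q σ → Within Q n skip σ
    step : ∀ {n c σ} → c ≢ skip →
           (∀ {t c′ σ′} (s : (c , σ) ⟶[ t ] (c′ , σ′)) →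
              ∃[ n′ ] unrollings s + n′ ≤ n × Within Q n′ c′ σ′) →
           (Live → ∃[ t ] ∃[ κ ] (c , σ) ⟶[ t ] κ) →
           Within Q n c σ

  -- The potential is `flat c` plus `K` for every iteration left in the budget. As `κ` is any
  -- configuration reached and every transition takes time at least 1, this also rules out infinite
  -- runs.
  within-time : ∀ {Q K n c σ t κ} → loopCost c ≤ K → Within Q n c σ →
                (c , σ) ⟶*[ t ] κ → t ≤ flat c + n * K
  within-time le w ε = z≤n
  within-time le (done _) (() ◅ _)
  within-time {K = K} {n} {c} le (step _ f _) (_◅_ {κ′ = c′ , _} {t = t} {u} s run) with f s
  ... | n′ , n′≤n , w = begin
    t + u                                   ≤⟨ +-monoʳ-≤ t (within-time (≤-trans (step-loopCost s) le) w run) ⟩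
    t + (flat c′ + n′ * K)                  ≡⟨ +-assoc t _ _ ⟨
    t + flat c′ + n′ * K                    ≤⟨ +-monoˡ-≤ _ (step-flat s le) ⟩
    flat c + unrollings s * K + n′ * K      ≡⟨ +-assoc (flat c) _ _ ⟩
    flat c + (unrollings s * K + n′ * K)    ≡⟨ cong (flat c +_) (*-distribʳ-+ K (unrollings s) n′) ⟨
    flat c + (unrollings s + n′) * K        ≤⟨ +-monoʳ-≤ (flat c) (*-monoˡ-≤ K n′≤n) ⟩
    flat c + n * K                          ∎
    where open ≤-Reasoning

  -- A configuration in the case `step` has a successor under `Live`, so a run can only stop in the
  -- case `done`.
  within-terminal : ∀ {Q n c σ t c′ σ′} → Live → Within Q n c σ →
                    (c , σ) ⟶*[ t ] (c′ , σ′) → Terminal (c′ , σ′) → c′ ≡ skip × Q σ′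
  within-terminal l (done q) ε _ = refl , q
  within-terminal l (done _) (() ◅ _) _
  within-terminal l (step _ _ live) ε stop = ⊥-elim (stop (proj₂ (proj₂ (live l))))
  within-terminal l (step _ f _) (s ◅ run) stop with f s
  ... | _ , _ , w = within-terminal l w run stop

  weaken : ∀ {Q n n′ c σ} → n ≤ n′ → Within Q n c σ → Within Q n′ c σ
  weaken le (done q)        = done q
  weaken le (step c≢ f live) = step c≢ (λ s → let n , n≤ , w = f s in n , ≤-trans n≤ le , w) live

  map : ∀ {Q R n c σ} → (∀ {σ} → Q σ → R σ) → Within Q n c σ → Within R n c σ
  map g (done q)         = done (g q)
  map g (step c≢ f live) = step c≢ (λ s → let n , n≤ , w = f s in n , n≤ , map g w) live

  infixr 1 _⟫_
  _⟫_ : ∀ {Q R k n c d σ} → Within Q k c σ → (∀ {σ′} → Q σ′ → Within R n d σ′) →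
        Within R (k + n) (c ⨾ d) σ
  _⟫_ {k = k} {n} (done q) g =
    step (λ ()) (λ { next → n , m≤n+m n k , g q ; (seq ()) }) (λ _ → _ , _ , next)
  _⟫_ {R = R} {k} {n} {d = d} {σ} (step {c = c} c≢ f live) g = step (λ ()) after
    (λ l → let _ , _ , s = live l in _ , _ , seq s)
    where
    after : ∀ {t c′ σ′} (s : (c ⨾ d , σ) ⟶[ t ] (c′ , σ′)) →
            ∃[ n′ ] unrollings s + n′ ≤ k + n × Within R n′ c′ σ′
    -- This is where `Within` needs its field `c ≢ skip`: control cannot pass to `d` before `c` has
    -- finished.
    after next = ⊥-elim (c≢ refl)
    after (seq s) with f s
    ... | n′ , n′≤k , w =
      n′ + n , ≤-trans (≤-reflexive (sym (+-assoc (unrollings s) n′ n))) (+-monoˡ-≤ n n′≤k) , (w ⟫ g)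

  -- A draw must satisfy the postcondition for every outcome, and have some outcome if `Live` holds.
  -- The clause for loops, with budget 0, can only be met by a loop whose test fails at once; real
  -- loops are treated by the rules below.
  wp : Cmd → (State → Set) → State → Set
  wp skip                  Q σ = Q σ
  wp (x ≔ e)               Q σ = Q (setReg x (⟦ e ⟧ σ) σ)
  wp (a [ e ]≔ f)          Q σ = Q (setMem a (⟦ e ⟧ σ) (⟦ f ⟧ σ) σ)
  wp (x ←uniform e)        Q σ = (Live → 0 < ⟦ e ⟧ σ) × (∀ r → r < ⟦ e ⟧ σ → Q (setReg x r σ))
  wp (c ⨾ d)               Q σ = wp c (wp d Q) σ
  wp (if b then c else′ d) Q σ = (Holds b σ → wp c Q σ) × (¬ Holds b σ → wp d Q σ)
  wp (while b repeat c)    Q σ = Within Q 0 (while b repeat c) σ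

  straight : ∀ c {Q σ} → wp c Q σ → Within Q 0 c σ
  straight skip         q = done q
  straight (x ≔ e)      q = step (λ ()) (λ { assign → 0 , z≤n , done q }) (λ _ → _ , _ , assign)
  straight (a [ e ]≔ f) q = step (λ ()) (λ { store → 0 , z≤n , done q }) (λ _ → _ , _ , store)
  straight (x ←uniform e) (pos , q) =
    step (λ ()) (λ { (draw r<) → 0 , z≤n , done (q _ r<) }) (λ l → _ , _ , draw (pos l))
  straight (c ⨾ d) q = straight c q ⟫ straight d
  straight (if b then c else′ d) {Q} {σ} (y , n) =
    step (λ ())
      (λ { (if-yes h) → 0 , z≤n , straight c (y h) ; (if-no h) → 0 , z≤n , straight d (n h) })
      (λ _ → can (holds? b σ))
    where
    can : Dec (Holds b σ) → _
    can (yes h) = _ , _ , if-yes h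
    can (no h)  = _ , _ , if-no h
  straight (while b repeat c) w = w

  -- Loop rules with iteration budgets

  while-unfold : ∀ {Q n b c σ} →
    (Holds b σ → ∃[ n′ ] suc n′ ≤ n × Within Q n′ (c ⨾ while b repeat c) σ) →
    (¬ Holds b σ → Q σ) → Within Q n (while b repeat c) σ
  while-unfold {b = b} {c} {σ} more stop =
    step (λ ()) (λ { (loop h) → more h ; (exit h) → 0 , z≤n , done (stop h) })
      (λ _ → can (holds? b σ))
    where
    can : Dec (Holds b σ) → _
    can (yes h) = _ , _ , loop h
    can (no h)  = _ , _ , exit h

  -- The index `r` bounds the iterations to come; each lowers it by one and pays 1 for the unrolling
  -- and `k` for the body. The final index is left open because a loop may stop early, as `shuffle`
  -- does at 1.
  while-rule : ∀ {b c k} (I : ℕ → State → Set) →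
    (∀ {r σ} → I r σ → Holds b σ → ∃[ r′ ] r ≡ suc r′ × Within (I r′) k c σ) →
    ∀ r {σ} → I r σ →
    Within (λ σ′ → (∃[ r′ ] I r′ σ′) × ¬ Holds b σ′) (r * suc k) (while b repeat c) σ
  while-rule {b} {c} {k} I body r {σ} i = while-unfold (λ h → more r i (body i h)) (λ h → (r , i) , h)
    where
    more : ∀ r → I r σ → ∃[ r′ ] r ≡ suc r′ × Within (I r′) k c σ →
           ∃[ n ] suc n ≤ r * suc k ×
             Within (λ σ′ → (∃[ r′ ] I r′ σ′) × ¬ Holds b σ′) n (c ⨾ while b repeat c) σ
    more (suc r) i (.r , refl , w) = _ , ≤-refl , (w ⟫ while-rule I body r)

  -- The budget `f i` may vary with the iteration, as RSP requires. `limit` ranges over all states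
  -- satisfying the invariant since the machine evaluates `e` anew at every test. After the body the
  -- invariant is asked of a state with the counter already advanced, so that the increment is dealt
  -- with once, in `advance`.
  for-rule : ∀ x {e c} (I : ℕ → State → Set) N (f : ℕ → ℕ) →
    (∀ {i σ} → reg σ x ≡ i → I i σ → ⟦ e ⟧ σ ≡ N) →
    (∀ {i σ} → i < N → reg σ x ≡ i → I i σ →
       Within (λ σ′ → reg σ′ x ≡ i × I (suc i) (setReg x (suc i) σ′)) (f i) c σ) →
    ∀ {σ} → I 0 (setReg x 0 σ) →
    Within (I N) (∑ N (suc ∘ f)) (for x below e repeat c) σ
  for-rule x {e} {c} I N f limit body {σ} i₀ =
    straight (x ≔ # 0) {λ σ → reg σ x ≡ 0 × I 0 σ} (reg-set x , i₀) ⟫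
      λ (eq , i₀) → go N refl refl eq i₀
    where
    reg-set : ∀ x {v} {σ : State} → reg (setReg x v σ) x ≡ v
    reg-set (register x) {σ = σ} = update-≡ (reg σ ∘ register) x
    g = suc ∘ f
    -- Here `d` iterations are left and `b` is the unspent budget.
    go : ∀ d {i b σ} → i + d ≡ N → ∑ i g + b ≡ ∑ N g → reg σ x ≡ i → I i σ →
         Within (I N) b (while $ x ≺ e repeat (c ⨾ x ≔ $ x ⊕ # 1)) σ
    go zero {i} eq _ xi inv rewrite +-identityʳ i | eq = while-unfold
      (λ h → ⊥-elim (<-irrefl (trans xi (sym (limit xi inv))) h))
      (λ _ → inv)
    go (suc d) {i} {b} {σ} eq budget xi inv = while-unfold
      -- The 0 is the budget of the counter increment, and `b′` that of the later iterations.
      (λ _ → f i + 0 + b′ , le , ((body i<N xi inv ⟫ λ {σ′} (xi′ , inv′) →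
         straight (x ≔ $ x ⊕ # 1) {λ σ → reg σ x ≡ suc i × I (suc i) σ}
           (advance σ′ xi′ inv′)) ⟫
         λ (xi′ , inv′) → go d (trans (sym (+-suc i d)) eq) (m+[n∸m]≡n Σ≤) xi′ inv′))
      (λ h → ⊥-elim (h (subst₂ _<_ (sym xi) (sym (limit xi inv)) i<N)))
      where
      i<N : i < N
      i<N = ≤-trans (s≤s (m≤m+n i d)) (≤-reflexive (trans (sym (+-suc i d)) eq))
      Σ≤ : ∑ (suc i) g ≤ ∑ N g
      Σ≤ = ∑-mono g i<N
      b′ = ∑ N g ∸ ∑ (suc i) g
      le : suc (f i + 0 + b′) ≤ b
      le = ≤-reflexive (+-cancelˡ-≡ (∑ i g) _ _ (begin
        ∑ i g + suc (f i + 0 + b′)  ≡⟨ cong (λ a → ∑ i g + suc (a + b′)) (+-identityʳ (f i)) ⟩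
        ∑ i g + (g i + b′)          ≡⟨ +-assoc (∑ i g) (g i) b′ ⟨
        ∑ (suc i) g + b′            ≡⟨ m+[n∸m]≡n Σ≤ ⟩
        ∑ N g                       ≡⟨ budget ⟨
        ∑ i g + b                   ∎))
        where open ≡-Reasoning
      advance : ∀ σ′ → reg σ′ x ≡ i → I (suc i) (setReg x (suc i) σ′) →
                let v = reg σ′ x + 1 in reg (setReg x v σ′) x ≡ suc i × I (suc i) (setReg x v σ′)
      advance σ′ xi inv rewrite xi | +-comm i 1 = reg-set x , inv

  for-uniform : ∀ x {e c} (I : ℕ → State → Set) N {k} →
    (∀ {i σ} → reg σ x ≡ i → I i σ → ⟦ e ⟧ σ ≡ N) →
    (∀ {i σ} → i < N → reg σ x ≡ i → I i σ →
       Within (λ σ′ → reg σ′ x ≡ i × I (suc i) (setReg x (suc i) σ′)) k c σ) →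
    ∀ {σ} → I 0 (setReg x 0 σ) →
    Within (I N) (N * suc k) (for x below e repeat c) σ
  for-uniform x I N {k} limit body i₀ =
    weaken (≤-reflexive (∑-const N (suc k))) (for-rule x I N (λ _ → k) limit body i₀)

  for-straight : ∀ x {e c} (I : ℕ → State → Set) N →
    (∀ {i σ} → reg σ x ≡ i → I i σ → ⟦ e ⟧ σ ≡ N) →
    (∀ {i σ} → i < N → reg σ x ≡ i → I i σ →
       wp c (λ σ′ → reg σ′ x ≡ i × I (suc i) (setReg x (suc i) σ′)) σ) →
    ∀ {σ} → I 0 (setReg x 0 σ) →
    Within (I N) N (for x below e repeat c) σ
  for-straight x {c = c} I N limit body i₀ =
    weaken (≤-reflexive (*-identityʳ N))
      (for-uniform x I N limit (λ i< xi inv → straight c (body i< xi inv)) i₀)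

-- One round of SE-C, for m = 2 + μ

module Round (Live : Set) (μ z n : ℕ) (1≤z : 1 ≤ z) where
  open Logic Live

  m : ℕ
  m = suc (suc μ)

  Params : ℕ → ℕ → State → Set
  Params v h σ =
    reg σ %m ≡ m × reg σ %z ≡ z × reg σ %n ≡ n × reg σ ∣V∣ ≡ v × reg σ ∣H∣ ≡ h

  Tab : ℕ → State → Set
  Tab k σ = Table k (reg σ %N) (mem σ Elem) (mem σ Freq) (mem σ Idx)

  Empty : State → Set
  Empty σ = reg σ %N ≡ 0 × (∀ x → mem σ Idx x ≡ 0)

  +1 : ∀ {a b} → a ≡ b → a + 1 ≡ suc b
  +1 {a} eq = trans (+-comm a 1) (cong suc eq)

  module _ {v h : ℕ} where

    -- The counter itself bounds the iterations left. `%s` is carried along because RSS sums the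
    -- frequencies before shuffling and divides afterwards.
    shuffle-within : ∀ {k N s} σ →
      let I = λ σ → Params v h σ × Tab k σ × reg σ %N ≡ N × reg σ %s ≡ s
      in I σ → Within I N shuffle σ
    shuffle-within {k} {N} {s} σ inv =
      straight _ {J N} (inv , proj₁ (proj₂ (proj₂ inv)) , ≤-refl) ⟫ λ j →
      weaken (≤-reflexive (*-identityʳ N)) (map (λ ((_ , i , _) , _) → i)
        (while-rule J (λ {r} {σ} → body r σ) N j))
      where
      J : ℕ → State → Set
      J r σ = (Params v h σ × Tab k σ × reg σ %N ≡ N × reg σ %s ≡ s) × reg σ %i ≡ r × r ≤ N

      body : ∀ r σ → J r σ → 1 < reg σ %i → ∃[ r′ ] r ≡ suc r′ × Within (J r′) 0 _ σ
      body zero    σ (_ , i≡ , _) 1<i with () ← subst (1 <_) i≡ 1<i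
      body (suc r) σ ((p , T , N≡ , s≡) , i≡ , r<N) _ = r , refl , straight _
        ( (λ _ → m≤n+m 1 _)
        , λ j j< → (p , swap-table i<N (≤-trans (subst (j <_) (+-comm _ 1) j<) i<N) T , N≡ , s≡)
                   , cong (_∸ 1) i≡ , <⇒≤ r<N)
        where
        i<N : reg σ %i ∸ 1 < reg σ %N
        i<N rewrite i≡ | N≡ = r<N

    -- After `i` iterations, every element with a nonzero index is still listed at some position
    -- from `i` on; once `i` reaches `N` there is no such position.
    clear-within : ∀ {k σ} → Params v h σ × Tab k σ →
                   Within (λ σ → Params v h σ × Empty σ) k clear σ
    clear-within {k} {σ} (p , T) =
      weaken (≤-trans (≤-reflexive (+-identityʳ N)) (size T))
        (for-straight %i I N (λ _ (_ , N≡ , _) → N≡) (λ {i} {σ} → body i σ)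
           (p , refl , λ x → listed₀ x (listed T x)) ⟫ λ (p , _ , l) →
         straight _ (p , refl , λ x → none (l x)))
      where
      N = reg σ %N
      I : ℕ → State → Set
      I i σ = Params v h σ × reg σ %N ≡ N ×
        (∀ x → mem σ Idx x ≡ 0 ⊎ ∃[ p ] i ≤ p × p < N × mem σ Elem p ≡ x)
      listed₀ : ∀ x → _ ⊎ _ → _ ⊎ _
      listed₀ x (inj₁ eq)             = inj₁ eq
      listed₀ x (inj₂ (p , p<N , eq)) = inj₂ (p , z≤n , p<N , eq)
      none : ∀ {A : Set} {B : ℕ → Set} → A ⊎ (∃[ p ] N ≤ p × p < N × B p) → A
      none (inj₁ a)                   = a
      none (inj₂ (p , N≤p , p<N , _)) = ⊥-elim (<⇒≱ p<N N≤p)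
      body : ∀ i σ → i < N → reg σ %i ≡ i → I i σ →
             reg σ %i ≡ i × I (suc i) (setMem Idx (mem σ Elem (reg σ %i)) 0 σ)
      body i σ _ i≡ (p , N≡ , l) = i≡ , p , N≡ , λ x → listed′ x (l x)
        where
        y = mem σ Elem (reg σ %i)
        listed′ : ∀ x → mem σ Idx x ≡ 0 ⊎ ∃[ p ] i ≤ p × p < N × mem σ Elem p ≡ x →
                  (mem σ Idx [ y ↦ 0 ]) x ≡ 0 ⊎ ∃[ p ] suc i ≤ p × p < N × mem σ Elem p ≡ x
        listed′ x l with y ≟ x
        listed′ x l | yes refl = inj₁ (update-≡ (mem σ Idx) y)
        listed′ x (inj₁ eq) | no y≢x = inj₁ (trans (update-≢ (mem σ Idx) y≢x) eq)
        listed′ x (inj₂ (p , i≤p , p<N , eq)) | no y≢x = inj₂ (p , ≤∧≢⇒< i≤p i≢p , p<N , eq)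
          where
          i≢p : i ≢ p
          i≢p refl = y≢x (trans (cong (mem σ Elem) i≡) eq)

    -- Three passes over at most `z * m` entries: summing, shuffling and selecting.
    rss-within : ∀ {σ} → let I = λ σ → Params v h σ × Tab (z * m) σ in
                 I σ → Within I (z * m + (z * m + z * m)) (rss ($ %m)) σ
    rss-within {σ} (p , T) =
      straight _ {λ σ → I σ × reg σ %s ≡ 0} ((p , T , refl) , refl) ⟫ λ {σ} (i , s≡) →
      weaken N≤ (for-straight %i
        (λ i σ → I σ × reg σ %s ≡ ∑ i (mem σ Freq)) N (λ _ ((_ , _ , N≡) , _) → N≡)
        (λ { {_} {σ} _ refl (i , s≡) → refl , i , cong (_+ mem σ Freq (reg σ %i)) s≡ })
        (i , s≡)) ⟫ λ {σ} ((p , T , N≡) , s≡) →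
      weaken N≤ (shuffle-within σ (p , T , N≡ , trans s≡ (s≡total {σ} T N≡))) ⟫ λ (p , T , N≡ , s≡) →
      straight _ {I} ((λ _ → quo-pos s≡ (proj₁ p)) , λ _ _ → p , T , N≡) ⟫ λ i →
      straight _ {I} i ⟫ λ i →
      straight _ {I} i ⟫ λ i →
      weaken N≤ (map (λ (p , T , _) → p , T) (for-straight %i (λ _ → I) N (λ _ (_ , _ , N≡) → N≡)
        (λ _ i≡ i → (λ _ → i≡ , i) , (λ _ → i≡ , i))
        i))
      where
      N = reg σ %N
      N≤ : N ≤ z * m
      N≤ = size T
      I : State → Set
      I σ = Params v h σ × Tab (z * m) σ × reg σ %N ≡ N
      s≡total : ∀ {σ} → Tab (z * m) σ → reg σ %N ≡ N → ∑ N (mem σ Freq) ≡ z * m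
      s≡total {σ} T N≡ = trans (cong (λ N → ∑ N (mem σ Freq)) (sym N≡)) (total T)
      quo-pos : ∀ {a b} → a ≡ z * m → b ≡ m → 0 < quo a b
      quo-pos refl refl = subst (0 <_) (sym (m*n/n≡m z m)) 1≤z

    rsp-within : ∀ {k σ} → Params v h σ × Tab k σ →
                 Within (λ σ → Params v h σ × Tab k σ) (m + (k + (k + k))) (rsp ($ %m) ($ %m)) σ
    rsp-within {k} {σ} (p , T) =
      for-straight %k (λ _ → I) m (λ _ (p , _) → proj₁ p) (λ _ k≡ i → k≡ , i) (p , T , refl) ⟫ λ i →
      straight _ {I} i ⟫ λ {σ} (p , T , N≡) →
      weaken N≤ (shuffle-within σ (p , T , N≡ , refl)) ⟫ λ {σ₀} (p , T , N≡ , _) →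
      -- The frequencies are frozen after the shuffle, so that the budget of the inner loop is a
      -- fixed function of the outer counter; `J` records that they do not change any more.
      let f₀ = mem σ₀ Freq
          J  = λ σ → I σ × (∀ q → mem σ Freq q ≡ f₀ q)
      in
      weaken (cost σ₀ T N≡) (map (λ ((p , T , _) , _) → p , T)
        (for-rule %i (λ _ → J) N f₀ (λ _ ((_ , _ , N≡) , _) → N≡)
          (λ {i} _ i≡ j → for-straight %j (λ _ σ → reg σ %i ≡ i × J σ) (f₀ i)
            (λ {_} {σ} _ (i≡ , _ , f≡) → trans (f≡ (reg σ %i)) (cong f₀ i≡))
            (λ _ j≡ j → j≡ , j) (i≡ , j))
          ((p , T , N≡) , λ _ → refl)))
      where
      N = reg σ %N
      N≤ : N ≤ k
      N≤ = size T
      I : State → Set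
      I σ = Params v h σ × Tab k σ × reg σ %N ≡ N
      cost : ∀ σ → Tab k σ → reg σ %N ≡ N → ∑ N (suc ∘ mem σ Freq) ≤ k + k
      cost σ T N≡ = begin
        ∑ N (suc ∘ mem σ Freq)        ≡⟨ ∑-suc N _ ⟩
        N + ∑ N (mem σ Freq)          ≡⟨ cong (λ M → N + ∑ M (mem σ Freq)) N≡ ⟨
        N + ∑ (reg σ %N) (mem σ Freq) ≡⟨ cong (N +_) (total T) ⟩
        N + k                         ≤⟨ +-monoˡ-≤ k N≤ ⟩
        k + k                         ∎
        where open ≤-Reasoning

    select-within : (Live → 0 < h) → ∀ {σ} → let I = λ σ → Params v h σ × Empty σ in
                    I σ → Within I z selectHyperedges σ
    select-within 0<h = for-straight %k (λ _ σ → Params v h σ × Empty σ) z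
      (λ _ ((_ , z≡ , _) , _) → z≡)
      (λ { _ k≡ i@((_ , _ , _ , _ , h≡) , _) →
        (λ l → subst (0 <_) (sym h≡) (0<h l)) , λ _ _ → k≡ , i })

    sample-within : ∀ {σ} → let I = λ σ → Params v h σ × Empty σ in
                    I σ → Within I (z * suc m + (z * m + (z * m + z * m) + z * m)) sampleVertices σ
    sample-within (p , N≡ , idx≡) =
      for-uniform %k (λ k σ → Params v h σ × Tab (k * m) σ) z (λ _ ((_ , z≡ , _) , _) → z≡)
        (λ {k} _ k≡ (p , T) → for-straight %i
          -- With i first, i = m gives suc k * m definitionally.
          (λ i σ → reg σ %k ≡ k × Params v h σ × Tab (i + k * m) σ) m
          (λ _ (_ , (m≡ , _) , _) → m≡)
          (λ {_} {σ} _ i≡ (k≡ , p , T) →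
            let a = mem σ Hyp (mem σ Sel (reg σ %k) * reg σ %m + reg σ %i) in
            (λ _ → i≡ , k≡ , p , tally-new a T) , (λ idx≢0 → i≡ , k≡ , p , tally-old a idx≢0 T))
          (k≡ , p , T))
        (p , empty-table N≡ idx≡) ⟫ λ i →
      rss-within i ⟫ clear-within

    attach-within : ∀ {σ} → Params v h σ × Empty σ →
                    Within (λ σ → Params (suc v) h σ × Empty σ) m attachVertex σ
    attach-within (p , e) =
      straight _ {λ σ → Params v h σ × Empty σ} (p , e) ⟫ λ ((m≡ , z≡ , n≡ , v≡ , h≡) , e) →
      straight _ {λ σ → Params (suc v) h σ × Empty σ} ((m≡ , z≡ , n≡ , +1 v≡ , h≡) , e) ⟫
      for-straight %i (λ _ σ → Params (suc v) h σ × Empty σ) m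
        (λ _ ((m≡ , _) , _) → m≡) (λ _ i≡ i → i≡ , i)

  -- Removal number `k` draws from `h ∸ k` hyperedges, a positive number under `Live` because
  -- `k < μ ≤ h`. The machine subtracts with truncation too, so the count is also correct without
  -- `Live`.
  update-within : ∀ {v h σ} → (Live → μ ≤ h) → Params v h σ × Empty σ →
    Within (λ σ → Params v (m + (h ∸ μ)) σ × Empty σ)
           (μ * suc m + (m + (m + (m * m +
             (m + (m * m + (m * m + m * m)) + (m * m + m * suc m))))))
           updateHyperedges σ
  update-within {v} {h} μ≤h (p , e) =
    straight _ {λ σ → Params v h σ × Empty σ × reg σ %q ≡ 0} (p , e , refl) ⟫ λ i →
    for-uniform %k (λ k σ → Params v (h ∸ k) σ × Empty σ × reg σ %q ≡ k * m) μ
      (λ _ ((m≡ , _) , _) → cong (_∸ 2) m≡)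
      (λ {k} k<μ k≡ (p@(_ , _ , _ , _ , h≡) , e , q≡) →
        straight _ {λ σ → reg σ %k ≡ k × Params v (h ∸ k) σ × Empty σ × reg σ %q ≡ k * m}
          ((λ l → subst (0 <_) (sym h≡) (m<n⇒0<n∸m (≤-trans k<μ (μ≤h l))))
          , λ _ _ → k≡ , p , e , q≡) ⟫
        λ (k≡ , (m≡ , z≡ , n≡ , v≡ , h≡) , e , q≡) →
        straight _ {λ σ → reg σ %k ≡ k × Params v (h ∸ suc k) σ × Empty σ × reg σ %q ≡ k * m}
          (k≡ , (m≡ , z≡ , n≡ , v≡ , trans (cong (_∸ 1) h≡) (pred[m∸n]≡m∸[1+n] h k)) , e , q≡) ⟫
        for-straight %i
          (λ i σ → reg σ %k ≡ k × Params v (h ∸ suc k) σ × Empty σ × reg σ %q ≡ i + k * m) m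
          (λ _ (_ , (m≡ , _) , _) → m≡)
          (λ _ i≡ (k≡ , p , e , q≡) → i≡ , k≡ , p , e , +1 q≡))
      i ⟫ λ i →
    for-straight %i (λ i σ → Params v (h ∸ μ) σ × Empty σ × reg σ %q ≡ i + μ * m) m
      (λ _ ((m≡ , _) , _) → m≡) (λ _ i≡ (p , e , q≡) → i≡ , p , e , +1 q≡) i ⟫ λ i →
    -- At `i = m` the size of the bag is `m + (m + μ * m)`, which is `m * m` by computation as `m`
    -- is `2 + μ`.
    for-straight %i (λ i σ → Params v (h ∸ μ) σ × Empty σ × reg σ %q ≡ i + (m + μ * m)) m
      (λ _ ((m≡ , _) , _) → m≡) (λ _ i≡ (p , e , q≡) → i≡ , p , e , +1 q≡) i ⟫
    λ (p , (N≡ , idx≡) , q≡) →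
    for-straight %l (λ l σ → Params v (h ∸ μ) σ × Tab l σ × reg σ %q ≡ m * m) (m * m)
      (λ _ (_ , _ , q≡) → q≡)
      (λ {_} {σ} _ l≡ (p , T , q≡) → let a = mem σ Bag (reg σ %l) in
        (λ _ → l≡ , p , tally-new a T , q≡) , (λ idx≢0 → l≡ , p , tally-old a idx≢0 T , q≡))
      (p , empty-table N≡ idx≡ , q≡) ⟫ λ (p , T , _) →
    rsp-within (p , T) ⟫ λ i →
    clear-within i ⟫
    for-uniform %k (λ k σ → Params v (k + (h ∸ μ)) σ × Empty σ) m
      (λ _ ((m≡ , _) , _) → m≡)
      (λ {k} _ k≡ i → weaken (≤-reflexive (+-identityʳ m))
        (for-straight %i (λ i σ → reg σ %k ≡ k × Params v (k + (h ∸ μ)) σ × Empty σ) m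
          (λ _ (_ , (m≡ , _) , _) → m≡)
          (λ _ i≡ i → i≡ , i) (k≡ , i) ⟫ λ (k≡ , (m≡ , z≡ , n≡ , v≡ , h≡) , e) →
        straight _ (k≡ , (m≡ , z≡ , n≡ , v≡ , +1 h≡) , e)))

  -- Cost of one round and of the outer loop

  roundCost : ℕ
  roundCost = z + ((z * suc m + (z * m + (z * m + z * m) + z * m)) + (m +
    (μ * suc m + (m + (m + (m * m + (m + (m * m + (m * m + m * m)) + (m * m + m * suc m))))))))

  roundCost< : suc roundCost ≤ 14 * (z * m + m * m)
  roundCost< = begin
    -- The additional 1 is the unrolling of the outer loop. Termwise estimates give 14 copies of `y`
    -- and 7 of `x`; the next line adds 7 more of `x` to reach a multiple of `x + y`.
    suc roundCost  ≤⟨ 1≤y ⟨+⟩ z≤x ⟨+⟩ (zsm≤ ⟨+⟩ ≤-refl {x + (x + x) + x}) ⟨+⟩ m≤y ⟨+⟩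
                      (*-monoˡ-≤ (suc m) (m≤n+m μ 2) ⟨≤⟩ msm≤) ⟨+⟩ m≤y ⟨+⟩ m≤y ⟨+⟩ ≤-refl {y} ⟨+⟩
                      (m≤y ⟨+⟩ ≤-refl {y + (y + y)}) ⟨+⟩ (≤-refl {y} ⟨+⟩ msm≤) ⟩
    bound x y      ≤⟨ m≤m+n (bound x y) (7 * x) ⟩
    bound x y + 7 * x  ≡⟨ collect x y ⟩
    14 * (x + y)   ∎
    where
    open ≤-Reasoning
    infixr 6 _⟨+⟩_
    _⟨+⟩_ : ∀ {a b c d} → a ≤ b → c ≤ d → a + c ≤ b + d
    _⟨+⟩_ = +-mono-≤
    infixr 7 _⟨≤⟩_
    _⟨≤⟩_ : ∀ {a b c} → a ≤ b → b ≤ c → a ≤ c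
    _⟨≤⟩_ = ≤-trans
    x = z * m
    y = m * m
    bound : ℕ → ℕ → ℕ
    bound x y = y + (x + ((x + x + (x + (x + x) + x)) + (y +
      (y + y + (y + (y + (y + (y + (y + (y + y)) + (y + (y + y))))))))))
    1≤y : 1 ≤ y
    1≤y = s≤s z≤n
    z≤x : z ≤ x
    z≤x = m≤m*n z m
    m≤y : m ≤ y
    m≤y = m≤m*n m m
    zsm≤ : z * suc m ≤ x + x
    zsm≤ = ≤-reflexive (*-suc z m) ⟨≤⟩ (z≤x ⟨+⟩ ≤-refl {x})
    msm≤ : m * suc m ≤ y + y
    msm≤ = ≤-reflexive (*-suc m m) ⟨≤⟩ (m≤y ⟨+⟩ ≤-refl {y})
    collect : ∀ x y → y + (x + ((x + x + (x + (x + x) + x)) + (y +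
      (y + y + (y + (y + (y + (y + (y + (y + y)) + (y + (y + y)))))))))) + 7 * x ≡ 14 * (x + y)
    collect = solve-∀

  -- The number of missing vertices decreases by one per round. As the vertex count never exceeds
  -- `n`, failure of the test forces equality.
  SE-C-within : ∀ {v h σ} → v ≤ n → (Live → 1 ≤ h × μ ≤ h) → Params v h σ × Empty σ →
                Within (λ σ → reg σ ∣V∣ ≡ n) ((n ∸ v) * suc roundCost) SE-C σ
  SE-C-within {v} {h} {σ} v≤n live (p , e) =
    map (λ {σ} ((r , i) , ∣V∣≮n) → finished r σ i ∣V∣≮n)
      (while-rule I (λ {r} {σ} → body r σ) (n ∸ v) (v , h , p , e , m+[n∸m]≡n v≤n , live))
    where
    I : ℕ → State → Set
    I r σ = ∃[ v ] ∃[ h ] Params v h σ × Empty σ × v + r ≡ n × (Live → 1 ≤ h × μ ≤ h)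

    finished : ∀ r σ → I r σ → ¬ reg σ ∣V∣ < reg σ %n → reg σ ∣V∣ ≡ n
    finished r σ (v , _ , (_ , _ , n≡ , v≡ , _) , _ , v+r≡n , _) ∣V∣≮n =
      ≤-antisym (subst (_≤ n) (sym v≡) (m+n≤o⇒m≤o v (≤-reflexive v+r≡n)))
                (subst (_≤ reg σ ∣V∣) n≡ (≮⇒≥ ∣V∣≮n))

    body : ∀ r σ → I r σ → reg σ ∣V∣ < reg σ %n →
           ∃[ r′ ] r ≡ suc r′ × Within (I r′) roundCost _ σ
    body zero σ (v , _ , (_ , _ , n≡ , v≡ , _) , _ , v+0≡n , _) ∣V∣<n =
      ⊥-elim (<⇒≢ ∣V∣<n (trans v≡ (trans (sym (+-identityʳ v)) (trans v+0≡n (sym n≡)))))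
    body (suc r) σ (v , h , p , e , v+r≡n , live) _ = r , refl ,
      (select-within (proj₁ ∘ live) (p , e) ⟫ λ i →
       sample-within i ⟫ λ i →
       attach-within i ⟫ λ i →
       map (λ (p , e) → suc v , m + (h ∸ μ) , p , e , trans (sym (+-suc v r)) v+r≡n ,
                         λ _ → s≤s z≤n , ≤-trans (m≤n+m μ 2) (m≤m+n m (h ∸ μ)))
         (update-within (proj₂ ∘ live) i))

-- Time of the whole run

total-cost : ∀ {F K R x t W} r → 1 ≤ W → R ≤ 14 * x → r * x ≤ W → t ≤ F + r * R * K →
             t ≤ (F + 14 * K) * W
total-cost {F} {K} {R} {x} {t} {W} r 1≤W R≤ rx≤W t≤ = begin
  t                         ≤⟨ t≤ ⟩
  -- Since `W` is at least 1, it absorbs the fixed cost `F`.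
  F + r * R * K             ≤⟨ +-mono-≤ (m≤m*n F W {{>-nonZero 1≤W}}) (*-monoˡ-≤ K (*-monoʳ-≤ r R≤)) ⟩
  F * W + r * (14 * x) * K  ≡⟨ regroup F r K x W ⟩
  F * W + 14 * K * (r * x)  ≤⟨ +-monoʳ-≤ (F * W) (*-monoʳ-≤ (14 * K) rx≤W) ⟩
  F * W + 14 * K * W        ≡⟨ *-distribʳ-+ W F (14 * K) ⟨
  (F + 14 * K) * W          ∎
  where
  open ≤-Reasoning
  regroup : ∀ F r K x W → F * W + r * (14 * x) * K ≡ F * W + 14 * K * (r * x)
  regroup = solve-∀

module Runs {μ z n : ℕ} (1≤z : 1 ≤ z) (S : Seed (suc (suc μ))) (order≤n : Seed.order S ≤ n) where
  open Seed S using (order; connected; hyperedges) public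

  -- Making the size conditions on the initial list the liveness hypothesis lets a single derivation
  -- give both the unconditional time bound and the conditional statement about terminal
  -- configurations.
  Live : Set
  Live = 1 ≤ length hyperedges × μ ≤ length hyperedges

  open Logic Live public
  open Round Live μ z n 1≤z public

  within : Within (λ σ → reg σ ∣V∣ ≡ n) ((n ∸ order) * suc roundCost) SE-C (initial S z n)
  within = SE-C-within order≤n (λ l → l) ((refl , refl , refl , refl , refl) , refl , λ _ → refl)

  1≤W : 1 ≤ n * m * z + n * (m * m)
  1≤W = ≤-trans (*-mono-≤ 1≤n (s≤s z≤n)) (m≤n+m (n * (m * m)) (n * m * z))
    where
    -- A connected graph has a vertex by definition.
    1≤n : 1 ≤ n
    1≤n = ≤-trans (>-nonZero⁻¹ order {{proj₁ connected}}) order≤n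

  rounds≤ : (n ∸ order) * (z * m + m * m) ≤ n * m * z + n * (m * m)
  rounds≤ = ≤-trans (*-monoˡ-≤ (z * m + m * m) (m∸n≤m n order)) (≤-reflexive (expand n m z))
    where
    expand : ∀ n m z → n * (z * m + m * m) ≡ n * m * z + n * (m * m)
    expand = solve-∀

theorem23 : ∃[ C ] ∀ (m z n : ℕ) → 2 ≤ m → 1 ≤ z → (S : Seed m) → Seed.order S ≤ n →
    (∀ {t κ} → (SE-C , initial S z n) ⟶*[ t ] κ → t ≤ C * (n * m * z + n * (m * m)))
    × (1 ≤ length (Seed.hyperedges S) → m ∸ 2 ≤ length (Seed.hyperedges S) →
    ∀ {t c σ} → (SE-C , initial S z n) ⟶*[ t ] (c , σ) → Terminal (c , σ) →
    c ≡ skip × reg σ ∣V∣ ≡ n)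
-- Both summands are computed from the program text alone, so the constant is independent of `m`,
-- `z`, `n` and the seed.
theorem23 = flat SE-C + 14 * loopCost SE-C , λ
  { (suc (suc _)) z n (s≤s (s≤s z≤n)) 1≤z S order≤n → let open Runs 1≤z S order≤n in
      (λ run → total-cost {x = z * m + m * m} (n ∸ order) 1≤W roundCost< rounds≤
                 (within-time ≤-refl within run))
    , (λ 1≤h μ≤h run → within-terminal (1≤h , μ≤h) within run)
  }
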